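{- Let $G$ and $H$ be connected graphs. If the Cartesian product $G \,\Box\, H$ is well-dominated, then either $G$ or $H$ is well-dominated (i.e. at least one of $G$, $H$ is well-dominated).
   Context: All graphs are finite and simple. A set $D\subseteq V(G)$ is a dominating set of $G$ if every vertex of $G$ is in $D$ or adjacent to a vertex of $D$; it is minimal if no proper subset of it is dominating. A graph is well-dominated if all of its minimal (with respect to inclusion) dominating sets have the same cardinality. The Cartesian product $G\,\Box\, H$ has vertex set $V(G)\times V(H)$, and $(g_1,h_1)$, $(g_2,h_2)$ are adjacent iff ($g_1=g_2$ and $h_1h_2\in E(H)$) or ($h_1=h_2$ and $g_1g_2\in E(G)$). -}

module Defs where

open import Data.Fin.Base using (Fin)
open import Data.Fin.Properties using (*↔×; inj⇒≟)
open import Data.Fin.Subset using (Subset; ∣_∣; _⊂_) renaming (_∈_ to _∈ᶠ_)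
open import Data.Nat.Base using (ℕ; _*_)
open import Data.Product.Base using (∃; _×_; _,_)
open import Data.Product.Function.NonDependent.Propositional using (_×-↔_)
open import Data.Sum.Base using (_⊎_; inj₁; inj₂)
open import Function.Bundles using (_↔_; Inverse)
open import Function.Properties.Inverse using (↔-sym; ↔-trans; ↔⇒↣)
open import Level using (0ℓ)
open import Relation.Binary.Construct.Closure.ReflexiveTransitive using (Star)
open import Relation.Binary.Core using (Rel)
open import Relation.Binary.Definitions
  using (Decidable; DecidableEquality; Irreflexive; Symmetric)
open import Relation.Binary.PropositionalEquality using (_≡_; refl)
open import Relation.Nullary.Decidable using (_×-dec_; _⊎-dec_)
open import Relation.Nullary.Negation using (¬_)

-- Adjacency is required to be decidable so that a finite graph has its
-- classical meaning constructively.
record Graph : Set₁ where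
  infix 4 _~_ _~?_ _≟_ _∈_
  field
    Vertex   : Set
    order    : ℕ
    index    : Vertex ↔ Fin order
    _~_      : Rel Vertex 0ℓ
    _~?_     : Decidable _~_
    ~-sym    : Symmetric _~_
    ~-irrefl : Irreflexive _≡_ _~_

  _≟_ : DecidableEquality Vertex
  _≟_ = inj⇒≟ (↔⇒↣ index)

  -- Sets of vertices are represented as subsets of Fin order along index;
  -- cardinality and inclusion are then those of Data.Fin.Subset.
  VertexSet : Set
  VertexSet = Subset order

  _∈_ : Vertex → VertexSet → Set
  v ∈ D = Inverse.to index v ∈ᶠ D

  Dominating : VertexSet → Set
  Dominating D = ∀ v → v ∈ D ⊎ ∃ λ u → u ∈ D × v ~ u

  MinimalDominating : VertexSet → Set
  MinimalDominating D = Dominating D × (∀ E → E ⊂ D → ¬ Dominating E)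

  WellDominated : Set
  WellDominated = ∀ D E → MinimalDominating D → MinimalDominating E → ∣ D ∣ ≡ ∣ E ∣

  -- Star _~_ u v is the type of walks from u to v.
  Connected : Set
  Connected = ∀ u v → Star _~_ u v

open Graph using (Connected; WellDominated) public

infixr 7 _□_

_□_ : Graph → Graph → Graph
G □ H = record
  { Vertex   = G.Vertex × H.Vertex
  ; order    = G.order * H.order
  ; index    = ↔-trans (G.index ×-↔ H.index) (↔-sym *↔×)
  ; _~_      = _~_
  ; _~?_     = λ (g₁ , h₁) (g₂ , h₂) →
                 ((g₁ G.≟ g₂) ×-dec (h₁ H.~? h₂)) ⊎-dec ((h₁ H.≟ h₂) ×-dec (g₁ G.~? g₂))
  ; ~-sym    = λ where
                 (inj₁ (refl , h~)) → inj₁ (refl , H.~-sym h~)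
                 (inj₂ (refl , g~)) → inj₂ (refl , G.~-sym g~)
  ; ~-irrefl = λ where
                 refl (inj₁ (_ , h~)) → H.~-irrefl refl h~
                 refl (inj₂ (_ , g~)) → G.~-irrefl refl g~
  }
  where
  module G = Graph G
  module H = Graph H

  _~_ : Rel (G.Vertex × H.Vertex) 0ℓ
  (g₁ , h₁) ~ (g₂ , h₂) = (g₁ ≡ g₂ × h₁ H.~ h₂) ⊎ (h₁ ≡ h₂ × g₁ G.~ g₂)

{-# OPTIONS --safe #-}
module Submission where

-- If both factors are connected and not complete, their product P is not
-- well-dominated; a complete graph is well-dominated.
-- Let m, n be the orders of G, H. By Bollobás–Cockayne there are dominating sets
-- D of G and E of H all of whose members have external private neighbours, so
-- D × V(H) and V(G) × E are minimal dominating sets of P and |D| n = m |E| is the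
-- size of every minimal dominating set of P, hence a lower bound for dominating sets.
-- For the dominating set {x} × V(H) ∪ (V(G) ∖ N[x]) × E this bound reads
-- |N[x]| |E| ≤ n; summed over D it forces the blocks N[x], x ∈ D, to partition
-- V(G) and to have the same size n / |E|. Equality forbids deleting (x , e) from
-- that set, which yields an anchor v ∈ N(x) with N[v] ⊆ N[x]. Thanks to the anchors,
-- replacing the part of P inside one block N[x] × N[y] by any minimal dominating
-- set of that block gives a minimal dominating set of P. If neither N[x] nor N[y]
-- is a clique, some minimal dominating set of the block is too large. So all blocks
-- of G, say, are cliques; as no closed neighbourhood is larger than a block, G is
-- a disjoint union of cliques, hence complete.

open import Defs
open import Algebra.Properties.Semiring.Sum as SumProperties using ()
open import Data.Bool.Base using (Bool; true; false; if_then_else_)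
open import Data.Empty using (⊥; ⊥-elim)
open import Data.Fin.Base using (Fin; zero; suc; _↑ˡ_; _↑ʳ_; combine)
open import Data.Fin.Properties using (any?; all?; remQuot-combine)
open import Data.Fin.Subset using (∣_∣; ⁅_⁆; _⊂_) renaming (_∈_ to _∈ᶠ_)
open import Data.Fin.Subset.Properties using (_∈?_; nonempty?; Empty-unique; ∣⁅x⁆∣≡1; x∈⁅x⁆; x∈⁅y⁆⇒x≡y; ⊆-antisym)
open import Data.Nat.Base using (ℕ; zero; suc; _+_; _*_; _≤_; _<_; z≤n; s≤s; NonZero; >-nonZero)
open import Data.Nat.Induction using (<-wellFounded)
open import Data.Nat.Properties hiding (_≟_)
open import Data.Product.Base using (Σ; ∃; Σ-syntax; _×_; _,_; proj₁; proj₂; swap)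
open import Data.Sum.Base using (_⊎_; inj₁; inj₂)
open import Data.Vec.Base using (tabulate)
open import Data.Vec.Properties using (lookup⇒[]=; []=⇒lookup; lookup∘tabulate)
open import Function.Base using (_∘_; id)
open import Function.Bundles using (Inverse)
open import Induction.WellFounded using (Acc; acc)
open import Relation.Binary.Construct.Closure.ReflexiveTransitive using (Star; ε; _◅_)
open import Relation.Binary.PropositionalEquality
open import Relation.Nullary.Decidable
  using (Dec; yes; no; does; map′; ¬?; _×-dec_; _⊎-dec_; _→-dec_; dec-true; decidable-stable)
open import Relation.Nullary.Negation using (¬_; contradiction)
open import Relation.Unary using (Decidable; _⟨×⟩_; _∪_; ∁; U)
open import Relation.Unary.Properties using (_×?_; _∪?_; ∁?; U?)

open SumProperties +-*-semiring
  using (sum; sum-cong-≗; ∑-distrib-+; ∑-comm; *-distribˡ-sum; *-distribʳ-sum)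

-- Sums over `Fin n`.

sum-mono-≤ : ∀ {n} {f g : Fin n → ℕ} → (∀ i → f i ≤ g i) → sum f ≤ sum g
sum-mono-≤ {zero}  f≤g = z≤n
sum-mono-≤ {suc n} f≤g = +-mono-≤ (f≤g zero) (sum-mono-≤ (f≤g ∘ suc))

sum-mono-< : ∀ {n} {f g : Fin n → ℕ} → (∀ i → f i ≤ g i) → ∀ i → f i < g i → sum f < sum g
sum-mono-< f≤g zero    fi<gi = +-mono-<-≤ fi<gi (sum-mono-≤ (f≤g ∘ suc))
sum-mono-< f≤g (suc i) fi<gi = +-mono-≤-< (f≤g zero) (sum-mono-< (f≤g ∘ suc) i fi<gi)

sum-zero : ∀ {n} {f : Fin n → ℕ} → (∀ i → f i ≡ 0) → sum f ≡ 0
sum-zero {zero}  f≡0 = refl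
sum-zero {suc n} f≡0 = cong₂ _+_ (f≡0 zero) (sum-zero (f≡0 ∘ suc))

sum-single : ∀ {n} {f : Fin n → ℕ} i → (∀ j → j ≢ i → f j ≡ 0) → sum f ≡ f i
sum-single {suc n} {f} zero    f≡0 =
  trans (cong (f zero +_) (sum-zero λ j → f≡0 (suc j) λ ())) (+-identityʳ _)
sum-single {suc n} {f} (suc i) f≡0 =
  cong₂ _+_ (f≡0 zero λ ()) (sum-single i λ j j≢i → f≡0 (suc j) λ { refl → j≢i refl })

sum-++ : ∀ m {n} (f : Fin (m + n) → ℕ) →
  sum f ≡ sum (λ i → f (i ↑ˡ n)) + sum (λ j → f (m ↑ʳ j))
sum-++ zero    f = refl
sum-++ (suc m) f = trans (cong (f zero +_) (sum-++ m (f ∘ suc))) (sym (+-assoc (f zero) _ _))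

sum-combine : ∀ m {n} (f : Fin (m * n) → ℕ) →
  sum f ≡ sum (λ (i : Fin m) → sum (λ (j : Fin n) → f (combine i j)))
sum-combine zero        f = refl
sum-combine (suc m) {n} f =
  trans (sum-++ n f) (cong (sum (λ j → f (j ↑ˡ (m * n))) +_) (sum-combine m (λ i → f (n ↑ʳ i))))

-- Indicators of decidable propositions.

ind : {P : Set} → Dec P → ℕ
ind P? = if does P? then 1 else 0

ind-yes : {P : Set} (P? : Dec P) → P → ind P? ≡ 1
ind-yes (yes _) _ = refl
ind-yes (no ¬p) p = contradiction p ¬p

ind-no : {P : Set} (P? : Dec P) → ¬ P → ind P? ≡ 0
ind-no (yes p) ¬p = contradiction p ¬p
ind-no (no _)  _  = refl

ind-mono : {P Q : Set} (P? : Dec P) (Q? : Dec Q) → (P → Q) → ind P? ≤ ind Q?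
ind-mono (no _)  Q? P→Q = z≤n
ind-mono (yes p) Q? P→Q = ≤-reflexive (sym (ind-yes Q? (P→Q p)))

ind-× : {P Q : Set} (P? : Dec P) (Q? : Dec Q) → ind (P? ×-dec Q?) ≡ ind P? * ind Q?
ind-× (yes _) (yes _) = refl
ind-× (yes _) (no _)  = refl
ind-× (no _)  Q?      = refl

ind-⊎ : {P Q : Set} (P? : Dec P) (Q? : Dec Q) → (P → ¬ Q) → ind (P? ⊎-dec Q?) ≡ ind P? + ind Q?
ind-⊎ (yes p) (yes q) disj = contradiction q (disj p)
ind-⊎ (yes _) (no _)  _    = refl
ind-⊎ (no _)  (yes _) _    = refl
ind-⊎ (no _)  (no _)  _    = refl

ind-⊎-≤ : {P Q : Set} (P? : Dec P) (Q? : Dec Q) → ind (P? ⊎-dec Q?) ≤ ind P? + ind Q?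
ind-⊎-≤ (yes _) (yes _) = s≤s z≤n
ind-⊎-≤ (yes _) (no _)  = s≤s z≤n
ind-⊎-≤ (no _)  (yes _) = s≤s z≤n
ind-⊎-≤ (no _)  (no _)  = z≤n

∣tabulate∣ : ∀ {n} (b : Fin n → Bool) → ∣ tabulate b ∣ ≡ sum (λ i → if b i then 1 else 0)
∣tabulate∣ {zero}  b = refl
∣tabulate∣ {suc n} b with b zero
... | true  = cong suc (∣tabulate∣ (b ∘ suc))
... | false = ∣tabulate∣ (b ∘ suc)

-- Sums over vertices and sizes of decidable vertex predicates.

module Counting (Γ : Graph) where
  open Graph Γ public hiding (Connected; WellDominated)
  private
    from = Inverse.from index
    to   = Inverse.to index

  ∃? : {P : Vertex → Set} → Decidable P → Dec (∃ P)
  ∃? {P} P? = map′ (λ (i , p) → from i , p)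
                   (λ (v , p) → to v , subst P (sym (Inverse.strictlyInverseʳ index v)) p)
                   (any? (P? ∘ from))

  ∀? : {P : Vertex → Set} → Decidable P → Dec (∀ v → P v)
  ∀? {P} P? = map′ (λ p v → subst P (Inverse.strictlyInverseʳ index v) (p (to v)))
                   (λ p i → p (from i))
                   (all? (P? ∘ from))

  ∑ : (Vertex → ℕ) → ℕ
  ∑ f = sum (f ∘ from)

  ∑-cong : {f g : Vertex → ℕ} → (∀ v → f v ≡ g v) → ∑ f ≡ ∑ g
  ∑-cong f≗g = sum-cong-≗ (f≗g ∘ from)

  ∑-mono : {f g : Vertex → ℕ} → (∀ v → f v ≤ g v) → ∑ f ≤ ∑ g
  ∑-mono f≤g = sum-mono-≤ (f≤g ∘ from)

  ∑-mono-< : {f g : Vertex → ℕ} → (∀ v → f v ≤ g v) → ∀ v → f v < g v → ∑ f < ∑ g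
  ∑-mono-< {f} {g} f≤g v fv<gv = sum-mono-< (f≤g ∘ from) (to v)
    (subst (λ u → f u < g u) (sym (Inverse.strictlyInverseʳ index v)) fv<gv)

  ∑-+ : (f g : Vertex → ℕ) → ∑ (λ v → f v + g v) ≡ ∑ f + ∑ g
  ∑-+ f g = ∑-distrib-+ (f ∘ from) (g ∘ from)

  ∑-*ˡ : ∀ c (f : Vertex → ℕ) → ∑ (λ v → c * f v) ≡ c * ∑ f
  ∑-*ˡ c f = sym (*-distribˡ-sum c (f ∘ from))

  ∑-*ʳ : ∀ c (f : Vertex → ℕ) → ∑ (λ v → f v * c) ≡ ∑ f * c
  ∑-*ʳ c f = sym (*-distribʳ-sum c (f ∘ from))

  # : {P : Vertex → Set} → Decidable P → ℕ
  # P? = ∑ λ v → ind (P? v)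

  private
    variable
      P Q : Vertex → Set

  #-mono : (P? : Decidable P) (Q? : Decidable Q) → (∀ v → P v → Q v) → # P? ≤ # Q?
  #-mono P? Q? P⊆Q = ∑-mono λ v → ind-mono (P? v) (Q? v) (P⊆Q v)

  #-mono-< : (P? : Decidable P) (Q? : Decidable Q) → (∀ v → P v → Q v) →
    ∀ v → ¬ P v → Q v → # P? < # Q?
  #-mono-< P? Q? P⊆Q v ¬p q = ∑-mono-< (λ u → ind-mono (P? u) (Q? u) (P⊆Q u)) v
    (subst₂ _<_ (sym (ind-no (P? v) ¬p)) (sym (ind-yes (Q? v) q)) (s≤s z≤n))

  #-∪ : (P? : Decidable P) (Q? : Decidable Q) → (∀ v → P v → ¬ Q v) → # (P? ∪? Q?) ≡ # P? + # Q?
  #-∪ P? Q? disj = trans (∑-cong λ v → ind-⊎ (P? v) (Q? v) (disj v)) (∑-+ (λ v → ind (P? v)) (λ v → ind (Q? v)))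

  #-∪-≤ : (P? : Decidable P) (Q? : Decidable Q) → # (P? ∪? Q?) ≤ # P? + # Q?
  #-∪-≤ P? Q? = ≤-trans (∑-mono λ v → ind-⊎-≤ (P? v) (Q? v)) (≤-reflexive (∑-+ (λ v → ind (P? v)) (λ v → ind (Q? v))))

  #-singleton : ∀ v → # (_≟ v) ≡ 1
  #-singleton v = trans
    (sum-single (to v) λ j j≢ → ind-no (from j ≟ v) λ { refl → j≢ (sym (Inverse.strictlyInverseˡ index j)) })
    (ind-yes (from (to v) ≟ v) (Inverse.strictlyInverseʳ index v))

  infix 7 _∖_ _∖?_

  _∖_ : (Vertex → Set) → Vertex → (Vertex → Set)
  (P ∖ v) u = P u × u ≢ v

  _∖?_ : Decidable P → ∀ v → Decidable (P ∖ v)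
  (P? ∖? v) u = P? u ×-dec ¬? (u ≟ v)

  #-∖-< : (P? : Decidable P) → ∀ v → P v → # (P? ∖? v) < # P?
  #-∖-< P? v p = #-mono-< (P? ∖? v) P? (λ _ → proj₁) v (λ (_ , v≢v) → v≢v refl) p

  #-∖ : (P? : Decidable P) → ∀ v → P v → # P? ≡ suc (# (P? ∖? v))
  #-∖ P? v p = ≤-antisym
    (≤-trans (#-mono P? ((_≟ v) ∪? (P? ∖? v)) split)
      (≤-trans (#-∪-≤ (_≟ v) (P? ∖? v)) (≤-reflexive (cong (_+ # (P? ∖? v)) (#-singleton v)))))
    (#-∖-< P? v p)
    where
    split : ∀ u → _ → u ≡ v ⊎ _
    split u pu with u ≟ v
    ... | yes u≡v = inj₁ u≡v
    ... | no u≢v  = inj₂ (pu , u≢v)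

  #-∁ : (P? : Decidable P) → # P? + # (∁? P?) ≡ # U?
  #-∁ P? = trans (sym (#-∪ P? (∁? P?) λ _ p ¬p → ¬p p))
    (≤-antisym (#-mono (P? ∪? ∁? P?) U? _) (#-mono U? (P? ∪? ∁? P?) λ v _ → lem v))
    where
    lem : ∀ v → _ ⊎ ¬ _
    lem v with P? v
    ... | yes p = inj₁ p
    ... | no ¬p = inj₂ ¬p

  #-positive : (P? : Decidable P) → ∀ v → P v → 1 ≤ # P?
  #-positive P? v p = ≤-trans (≤-reflexive (sym (#-singleton v)))
    (#-mono (_≟ v) P? λ { _ refl → p })

  set : Decidable P → VertexSet
  set P? = tabulate λ i → does (P? (from i))

  ∣set∣ : (P? : Decidable P) → ∣ set P? ∣ ≡ # P?
  ∣set∣ P? = ∣tabulate∣ λ i → does (P? (from i))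

  ∈-set⁺ : (P? : Decidable P) → ∀ {v} → P v → v ∈ set P?
  ∈-set⁺ {P} P? {v} p = lookup⇒[]= (to v) _ (trans (lookup∘tabulate _ (to v))
    (dec-true (P? _) (subst P (sym (Inverse.strictlyInverseʳ index v)) p)))

  ∈ᶠ-set⁻ : (P? : Decidable P) → ∀ {i} → i ∈ᶠ set P? → P (from i)
  ∈ᶠ-set⁻ P? {i} i∈ with P? (from i) | trans (sym (lookup∘tabulate (λ j → does (P? (from j))) i)) ([]=⇒lookup i∈)
  ... | yes p | _ = p

  ∈-set⁻ : (P? : Decidable P) → ∀ {v} → v ∈ set P? → P v
  ∈-set⁻ {P} P? {v} v∈ = subst P (Inverse.strictlyInverseʳ index v) (∈ᶠ-set⁻ P? v∈)

-- Domination inside a region, private neighbours and minimality.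

module Domination (Γ : Graph) where
  open Counting Γ public

  infix 4 _≈_ _≈?_

  _≈_ : Vertex → Vertex → Set
  u ≈ v = u ≡ v ⊎ u ~ v

  _≈?_ : ∀ u v → Dec (u ≈ v)
  u ≈? v = (u ≟ v) ⊎-dec (u ~? v)

  ≈-refl : ∀ {v} → v ≈ v
  ≈-refl = inj₁ refl

  ≈-sym : ∀ {u v} → u ≈ v → v ≈ u
  ≈-sym (inj₁ refl) = inj₁ refl
  ≈-sym (inj₂ u~v)  = inj₂ (~-sym u~v)

  -- The region `B` is `U` for domination of the whole graph, `_≢ u` for external private
  -- neighbours, and a closed neighbourhood or a product of two for work inside a block.
  Covers : (B T : Vertex → Set) → Set
  Covers B T = ∀ w → B w → ∃ λ u → T u × u ≈ w

  Private : (B T : Vertex → Set) → Vertex → Vertex → Set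
  Private B T u w = B w × u ≈ w × (∀ u′ → T u′ → u′ ≈ w → u′ ≡ u)

  Irredundant : (B T : Vertex → Set) → Set
  Irredundant B T = ∀ u → T u → ∃ (Private B T u)

  OpenIrredundant : (Vertex → Set) → Set
  OpenIrredundant T = ∀ u → T u → ∃ (Private (_≢ u) T u)

  private
    variable
      B T : Vertex → Set

  private? : Decidable B → Decidable T → ∀ u → Dec (∃ (Private B T u))
  private? B? T? u = ∃? λ w → B? w ×-dec (u ≈? w) ×-dec
    ∀? λ u′ → T? u′ →-dec (u′ ≈? w) →-dec (u′ ≟ u)

  -- Whatever no member other than `u` dominates is dominated by `u` alone, hence private to `u`.
  covers-∖ : Decidable T → ∀ u → Covers B T → ¬ ∃ (Private B T u) → Covers B (T ∖ u)
  covers-∖ T? u cov ¬priv w b with ∃? (λ u′ → (T? ∖? u) u′ ×-dec (u′ ≈? w))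
  ... | yes other = other
  ... | no ¬other = contradiction
    (w , b , subst (_≈ w) (only (proj₁ (proj₂ (cov w b))) (proj₂ (proj₂ (cov w b)))) (proj₂ (proj₂ (cov w b)))
       , λ _ → only)
    ¬priv
    where
    only : ∀ {u′} → _ → u′ ≈ w → u′ ≡ u
    only {u′} t u′≈w = decidable-stable (u′ ≟ u) λ u′≢u → ¬other (u′ , (t , u′≢u) , u′≈w)

  Refinement : (B T : Vertex → Set) → Set₁
  Refinement B T = Σ[ T′ ∈ (Vertex → Set) ]
    Decidable T′ × (∀ u → T′ u → T u) × Covers B T′ × Irredundant B T′

  -- A member without a private neighbour in `B` can be deleted; the size of `T` bounds the number
  -- of deletions.
  refine : Decidable B → (T? : Decidable T) → Covers B T → Acc _<_ (# T?) → Refinement B T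
  refine {B} {T} B? T? cov (acc rs) with ∃? (λ u → T? u ×-dec ¬? (private? B? T? u))
  ... | yes (u , t , ¬priv) =
    let T′ , T′? , T′⊆ , rest = refine B? (T? ∖? u) (covers-∖ T? u cov ¬priv) (rs (#-∖-< T? u t))
    in  T′ , T′? , (λ v t′ → proj₁ (T′⊆ v t′)) , rest
  ... | no ¬redundant =
    T , T? , (λ _ → id) , cov ,
    λ u t → decidable-stable (private? B? T? u) λ ¬priv → ¬redundant (u , t , ¬priv)

  dominating : (T? : Decidable T) → Covers U T → Dominating (set T?)
  dominating T? cov v with cov v _
  ... | _ , t , inj₁ refl = inj₁ (∈-set⁺ T? t)
  ... | u , t , inj₂ u~v  = inj₂ (u , ∈-set⁺ T? t , ~-sym u~v)

  -- A proper subset misses some member, whose private neighbour then stays undominated.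
  minimalDominating : (T? : Decidable T) → Covers U T → Irredundant U T → MinimalDominating (set T?)
  minimalDominating {T} T? cov irr = dominating T? cov , minimal
    where
    minimal : ∀ E → E ⊂ set T? → ¬ Dominating E
    minimal E (E⊆ , i , i∈ , i∉) domE = contradict
      where
      u = Inverse.from index i
      priv = irr u (∈ᶠ-set⁻ T? i∈)
      w = proj₁ priv
      only : ∀ u′ → T u′ → u′ ≈ w → u′ ≡ u
      only = proj₂ (proj₂ (proj₂ priv))
      impossible : ∀ {u′} → u′ ∈ E → u′ ≈ w → ⊥
      impossible {u′} u′∈ u′≈w = i∉ (subst (_∈ᶠ E)
        (trans (cong (Inverse.to index) (only u′ (∈-set⁻ T? (E⊆ u′∈)) u′≈w)) (Inverse.strictlyInverseˡ index i))
        u′∈)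
      contradict : ⊥
      contradict with domE w
      ... | inj₁ w∈            = impossible w∈ ≈-refl
      ... | inj₂ (u′ , u′∈ , w~u′) = impossible u′∈ (inj₂ (~-sym w~u′))

  -- The form in which the hypothesis on the product is used: the competitor `T` need only dominate,
  -- and two irredundant dominating sets get equal size by symmetry.
  IrredundantMinimum : Set₁
  IrredundantMinimum = ∀ {S T : Vertex → Set} (S? : Decidable S) (T? : Decidable T) →
    Covers U S → Irredundant U S → Covers U T → # S? ≤ # T?

  -- `T` contains a minimal dominating set, which has the size of `S`.
  wellDominated⇒irredundantMinimum : WellDominated Γ → IrredundantMinimum
  wellDominated⇒irredundantMinimum wd S? T? covS irrS covT
    with T′ , T′? , T′⊆T , covT′ , irrT′ ← refine U? T? covT (<-wellFounded _) = begin
      # S?          ≡⟨ ∣set∣ S? ⟨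
      ∣ set S? ∣    ≡⟨ wd _ _ (minimalDominating S? covS irrS) (minimalDominating T′? covT′ irrT′) ⟩
      ∣ set T′? ∣   ≡⟨ ∣set∣ T′? ⟩
      # T′?         ≤⟨ #-mono T′? T? T′⊆T ⟩
      # T?          ∎
    where open ≤-Reasoning

  -- Complete graphs.

  Complete : Set
  Complete = ∀ u v → u ≈ v

  complete? : Dec Complete
  complete? = ∀? λ u → ∀? λ v → u ≈? v

  nonempty : ∀ E → Dominating E → Fin order → ∃ (_∈ᶠ E)
  nonempty E dom i with dom (Inverse.from index i)
  ... | inj₁ v∈           = _ , v∈
  ... | inj₂ (_ , u∈ , _) = _ , u∈

  -- Any vertex dominates alone, so a minimal dominating set with a member is a singleton. An empty
  -- dominating set forces order 0, which rules out the mixed cases.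
  complete⇒wellDominated : Complete → WellDominated Γ
  complete⇒wellDominated complete D E minD minE with nonempty? D | nonempty? E
  ... | yes (i , i∈) | yes (j , j∈) = trans (size D minD i i∈) (sym (size E minE j j∈))
    where
    size : ∀ D → MinimalDominating D → ∀ i → i ∈ᶠ D → ∣ D ∣ ≡ 1
    size D (_ , minimal) i i∈ = trans (cong ∣_∣ (⊆-antisym D⊆ ⊆D)) (∣⁅x⁆∣≡1 i)
      where
      ⊆D : ∀ {j} → j ∈ᶠ ⁅ i ⁆ → j ∈ᶠ D
      ⊆D j∈ = subst (_∈ᶠ D) (sym (x∈⁅y⁆⇒x≡y i j∈)) i∈
      u = Inverse.from index i
      u∈ : u ∈ ⁅ i ⁆
      u∈ = subst (_∈ᶠ ⁅ i ⁆) (sym (Inverse.strictlyInverseˡ index i)) (x∈⁅x⁆ i)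
      dom : Dominating ⁅ i ⁆
      dom v with complete u v
      ... | inj₁ refl = inj₁ u∈
      ... | inj₂ u~v  = inj₂ (u , u∈ , ~-sym u~v)
      D⊆ : ∀ {j} → j ∈ᶠ D → j ∈ᶠ ⁅ i ⁆
      D⊆ {j} j∈ = decidable-stable (j ∈? ⁅ i ⁆) λ j∉ → minimal ⁅ i ⁆ (⊆D , j , j∈ , j∉) dom
  ... | no ¬D | no ¬E = cong ∣_∣ (trans (Empty-unique ¬D) (sym (Empty-unique ¬E)))
  ... | yes (i , _) | no ¬E = contradiction (nonempty E (proj₁ minE) i) ¬E
  ... | no ¬D | yes (j , _) = contradiction (nonempty D (proj₁ minD) j) ¬D

  -- Dominating sets with external private neighbours.

  NoIsolated : Set
  NoIsolated = ∀ v → ∃ λ w → w ≢ v × v ≈ w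

  Isolated : (Vertex → Set) → (Vertex → Set)
  Isolated T u = T u × (∀ u′ → T u′ → u′ ≈ u → u′ ≡ u)

  isolated? : Decidable T → Decidable (Isolated T)
  isolated? T? u = T? u ×-dec ∀? λ u′ → T? u′ →-dec (u′ ≈? u) →-dec (u′ ≟ u)

  -- Encodes the lexicographic order on size and number of isolated members: the second count is at
  -- most `# U?`, hence below the factor of the first.
  weight : Decidable T → ℕ
  weight T? = # T? * suc (# U?) + # (isolated? T?)

  weight-<ˡ : {T′ : Vertex → Set} (T? : Decidable T) (T′? : Decidable T′) →
    # T′? < # T? → weight T′? < weight T?
  weight-<ˡ T? T′? lt = begin-strict
    # T′? * suc (# U?) + # (isolated? T′?)  <⟨ +-monoʳ-< (# T′? * suc (# U?)) (s≤s (#-mono (isolated? T′?) U? _)) ⟩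
    # T′? * suc (# U?) + suc (# U?)         ≡⟨ +-comm (# T′? * suc (# U?)) _ ⟩
    suc (# T′?) * suc (# U?)                ≤⟨ *-monoˡ-≤ (suc (# U?)) lt ⟩
    # T? * suc (# U?)                       ≤⟨ m≤m+n _ _ ⟩
    weight T?                               ∎
    where open ≤-Reasoning

  record OpenDominatingSet : Set₁ where
    field
      {Member} : Vertex → Set
      member?  : Decidable Member
      covers   : Covers U Member
      open-irr : OpenIrredundant Member

  -- Bollobás–Cockayne: a vertex u of T without external private neighbour is
  -- either superfluous or isolated in T; in the second case trading it for a
  -- neighbour keeps the size of T and decreases the number of isolated vertices.
  openDominating : NoIsolated → (T? : Decidable T) → Covers U T → Acc _<_ (weight T?) → OpenDominatingSet
  openDominating {T} noIso T? cov (acc rs) with ∃? (λ u → T? u ×-dec ¬? (private? (λ w → ¬? (w ≟ u)) T? u))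
  ... | no ¬bad = record { member? = T? ; covers = cov ; open-irr = λ u t →
    decidable-stable (private? (λ w → ¬? (w ≟ u)) T? u) λ ¬priv → ¬bad (u , t , ¬priv) }
  ... | yes (u , t , ¬priv) with ∃? (λ u′ → (T? ∖? u) u′ ×-dec (u′ ≈? u))
  ...   | yes other = openDominating noIso (T? ∖? u) cov′ (rs (weight-<ˡ T? (T? ∖? u) (#-∖-< T? u t)))
    where
    cov′ : Covers U (T ∖ u)
    cov′ w _ with w ≟ u
    ... | yes refl = other
    ... | no w≢u   = covers-∖ T? u (λ w _ → cov w _) ¬priv w w≢u
  ...   | no ¬other = openDominating noIso T′? cov′ (rs (+-mono-≤-< (*-monoˡ-≤ (suc (# U?)) size) isolated-<))
    where
    v = proj₁ (noIso u)
    v≢u = proj₁ (proj₂ (noIso u))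
    u≈v = proj₂ (proj₂ (noIso u))
    ¬Tv : ¬ T v
    ¬Tv tv = ¬other (v , (tv , v≢u) , ≈-sym u≈v)
    T′ : Vertex → Set
    T′ = (_≡ v) ∪ (T ∖ u)
    T′? : Decidable T′
    T′? = (_≟ v) ∪? (T? ∖? u)
    cov∖ : Covers (_≢ u) (T ∖ u)
    cov∖ = covers-∖ T? u (λ w _ → cov w _) ¬priv
    cov′ : Covers U T′
    cov′ w _ with w ≟ u
    ... | yes refl = v , inj₁ refl , ≈-sym u≈v
    ... | no w≢u   = let u′ , t′ , u′≈w = cov∖ w w≢u in u′ , inj₂ t′ , u′≈w
    size : # T′? ≤ # T?
    size = begin
      # T′?                      ≤⟨ #-∪-≤ (_≟ v) (T? ∖? u) ⟩
      # (_≟ v) + # (T? ∖? u)     ≡⟨ cong (_+ # (T? ∖? u)) (#-singleton v) ⟩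
      suc (# (T? ∖? u))          ≡⟨ #-∖ T? u t ⟨
      # T?                       ∎
      where open ≤-Reasoning
    isolated-⊆ : ∀ w → Isolated T′ w → Isolated T w
    -- `v` is not isolated in `T′`: the member of `T ∖ u` that dominates it lies in `T`, while `v`
    -- does not.
    isolated-⊆ w (inj₁ refl , alone) =
      let u′ , t′ , u′≈v = cov∖ v v≢u
      in  contradiction (subst T (alone u′ (inj₂ t′) u′≈v) (proj₁ t′)) ¬Tv
    isolated-⊆ w (inj₂ (tw , w≢u) , alone) = tw , alone′
      where
      alone′ : ∀ u′ → T u′ → u′ ≈ w → u′ ≡ w
      alone′ u′ t′ u′≈w with u′ ≟ u
      -- `u` has no neighbour in `T`, so its removal isolates no other member.
      ... | yes refl  = contradiction (w , (tw , w≢u) , ≈-sym u′≈w) ¬other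
      ... | no  u′≢u  = alone u′ (inj₂ (t′ , u′≢u)) u′≈w
    u-isolated : Isolated T u
    u-isolated = t , λ u′ t′ u′≈u → decidable-stable (u′ ≟ u) λ u′≢u → ¬other (u′ , (t′ , u′≢u) , u′≈u)
    isolated-< : # (isolated? T′?) < # (isolated? T?)
    isolated-< = #-mono-< (isolated? T′?) (isolated? T?) isolated-⊆ u
      (λ { (inj₁ u≡v , _) → v≢u (sym u≡v) ; (inj₂ (_ , u≢u) , _) → u≢u refl }) u-isolated

  -- Covers of a closed neighbourhood by several vertices.

  Block : Vertex → Vertex → Set
  Block x v = x ≈ v

  block? : ∀ x → Decidable (Block x)
  block? x v = x ≈? v

  record ManyCover (x : Vertex) : Set₁ where
    field
      {Member}    : Vertex → Set
      member?     : Decidable Member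
      ⊆block      : ∀ v → Member v → x ≈ v
      x∉          : ¬ Member x
      covers      : Covers (Block x) Member
      irredundant : Irredundant (Block x) Member
      2≤#         : 2 ≤ # member?

  Partial : Vertex → Vertex → Set
  Partial x v = x ≈ v × ∃ λ w → x ≈ w × ¬ v ≈ w

  partial? : ∀ x → Decidable (Partial x)
  partial? x v = (x ≈? v) ×-dec ∃? λ w → (x ≈? w) ×-dec ¬? (v ≈? w)

  -- `a` misses `b`, and any `w` that `a` does not dominate misses `a`, so it may cover itself.
  covers-partial : ∀ {x a b} → x ≈ a → x ≈ b → ¬ a ≈ b → Covers (Block x) (Partial x)
  covers-partial {x} {a} {b} x≈a x≈b a≉b w x≈w with a ≈? w
  ... | yes a≈w = a , (x≈a , b , x≈b , a≉b) , a≈w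
  ... | no a≉w  = w , (x≈w , a , x≈a , a≉w ∘ ≈-sym) , ≈-refl

  -- No member of `Partial x` dominates the whole block, so an irredundant cover drawn from it needs
  -- a second member; `x`, which dominates the block, is excluded.
  manyCover : ∀ {x a b} → x ≈ a → x ≈ b → ¬ a ≈ b → ManyCover x
  manyCover {x} x≈a x≈b a≉b
    with L , L? , L⊆ , covL , irrL ← refine (block? x) (partial? x) (covers-partial x≈a x≈b a≉b) (<-wellFounded _)
    with d , d∈ , _ ← covL x ≈-refl
    with w , x≈w , d≉w ← proj₂ (L⊆ d d∈)
    with d′ , d′∈ , d′≈w ← covL w x≈w
    = record
    { member?     = L?
    ; ⊆block      = λ v l → proj₁ (L⊆ v l)
    ; x∉          = λ l → let _ , x≈u , x≉u = proj₂ (L⊆ x l) in x≉u x≈u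
    ; covers      = covL
    ; irredundant = irrL
    ; 2≤#         = ≤-trans (s≤s (#-positive (L? ∖? d) d′ (d′∈ , λ { refl → d≉w d′≈w })))
                            (≤-reflexive (sym (#-∖ L? d d∈)))
    }

-- Adjacency and counting in the Cartesian product.

module Product (G H : Graph) where
  private
    module G = Domination G
    module H = Domination H
    module P = Domination (G □ H)

  row : ∀ {g h h′} → h H.≈ h′ → (g , h) P.≈ (g , h′)
  row (inj₁ refl) = inj₁ refl
  row (inj₂ h~h′) = inj₂ (inj₁ (refl , h~h′))

  column : ∀ {g g′ h} → g G.≈ g′ → (g , h) P.≈ (g′ , h)
  column (inj₁ refl) = inj₁ refl
  column (inj₂ g~g′) = inj₂ (inj₂ (refl , g~g′))

  ≈-cases : ∀ {g g′ h h′} → (g , h) P.≈ (g′ , h′) → (g ≡ g′ × h H.≈ h′) ⊎ (h ≡ h′ × g G.≈ g′)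
  ≈-cases (inj₁ refl)                = inj₁ (refl , inj₁ refl)
  ≈-cases (inj₂ (inj₁ (g≡g′ , h~h′))) = inj₁ (g≡g′ , inj₂ h~h′)
  ≈-cases (inj₂ (inj₂ (h≡h′ , g~g′))) = inj₂ (h≡h′ , inj₂ g~g′)

  ∑-□ : (f : P.Vertex → ℕ) → P.∑ f ≡ G.∑ λ g → H.∑ λ h → f (g , h)
  ∑-□ f = trans (sum-combine G.order _) (sum-cong-≗ λ i → sum-cong-≗ λ j →
    cong (λ (i , j) → f (Inverse.from G.index i , Inverse.from H.index j)) (remQuot-combine i j))

  #-× : {A : G.Vertex → Set} {B : H.Vertex → Set} (A? : Decidable A) (B? : Decidable B) →
    P.# (A? ×? B?) ≡ G.# A? * H.# B?
  #-× A? B? = begin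
    P.# (A? ×? B?)                                  ≡⟨ ∑-□ (λ v → ind ((A? ×? B?) v)) ⟩
    G.∑ (λ g → H.∑ λ h → ind ((A? ×? B?) (g , h)))  ≡⟨ G.∑-cong (λ g → H.∑-cong λ h → ind-× (A? g) (B? h)) ⟩
    G.∑ (λ g → H.∑ λ h → ind (A? g) * ind (B? h))   ≡⟨ G.∑-cong (λ g → H.∑-*ˡ (ind (A? g)) (λ h → ind (B? h))) ⟩
    G.∑ (λ g → ind (A? g) * H.# B?)                 ≡⟨ G.∑-*ʳ (H.# B?) (λ g → ind (A? g)) ⟩
    G.# A? * H.# B?                                 ∎
    where open ≡-Reasoning

-- Makes results about the first factor available for the second, by exchanging coordinates.
flip-irredundantMinimum : (G H : Graph) →
  Domination.IrredundantMinimum (G □ H) → Domination.IrredundantMinimum (H □ G)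
flip-irredundantMinimum G H minimum {S} {T} S? T? covS irrS covT = begin
  Q.# S?             ≡⟨ #-swap S? ⟨
  P.# (S? ∘ swap)    ≤⟨ minimum (S? ∘ swap) (T? ∘ swap) (covers-swap covS) irr (covers-swap covT) ⟩
  P.# (T? ∘ swap)    ≡⟨ #-swap T? ⟩
  Q.# T?             ∎
  where
  open ≤-Reasoning
  module P = Domination (G □ H)
  module Q = Domination (H □ G)
  module G = Domination G
  module H = Domination H
  module GH = Product G H
  module HG = Product H G

  #-swap : {R : Q.Vertex → Set} (R? : Decidable R) → P.# (R? ∘ swap) ≡ Q.# R?
  #-swap R? = trans (GH.∑-□ (λ v → ind (R? (swap v))))
    (trans (∑-comm (λ i j → ind (R? (Inverse.from H.index j , Inverse.from G.index i))))
           (sym (HG.∑-□ (λ v → ind (R? v)))))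

  ≈-swap : ∀ {u v} → u Q.≈ v → swap u P.≈ swap v
  ≈-swap u≈v with HG.≈-cases u≈v
  ... | inj₁ (refl , g≈) = GH.column g≈
  ... | inj₂ (refl , h≈) = GH.row h≈

  ≈-swap⁻ : ∀ {u v} → swap u P.≈ swap v → u Q.≈ v
  ≈-swap⁻ u≈v with GH.≈-cases u≈v
  ... | inj₁ (refl , g≈) = HG.column g≈
  ... | inj₂ (refl , h≈) = HG.row h≈

  covers-swap : {R : Q.Vertex → Set} → Q.Covers U R → P.Covers U (R ∘ swap)
  covers-swap cov w _ = let u , r , u≈w = cov (swap w) _ in swap u , r , ≈-swap u≈w

  irr : P.Irredundant U (S ∘ swap)
  irr u s = let w , _ , u≈w , only = irrS (swap u) s
            in  swap w , _ , ≈-swap u≈w , λ u′ s′ u′≈w → cong swap (only (swap u′) s′ (≈-swap⁻ u′≈w))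

-- Double counting: the blocks partition `G` and have equal size.

module Blocks (G H : Graph) (minimum : Domination.IrredundantMinimum (G □ H))
  (𝒟 : Domination.OpenDominatingSet G) (ℰ : Domination.OpenDominatingSet H)
  (noIsolatedH : Domination.NoIsolated H) (h₀ : Graph.Vertex H) where

  private
    module G = Domination G
    module H = Domination H
    module P = Domination (G □ H)
    open Product G H
    open G.OpenDominatingSet 𝒟
      renaming (Member to D; member? to D?; covers to covD; open-irr to openD)
    open H.OpenDominatingSet ℰ
      renaming (Member to E; member? to E?; covers to covE; open-irr to openE)

    m = G.# U?
    n = H.# U?
    g = G.# D?
    k = H.# E?

  coversRows : P.Covers U (D ⟨×⟩ U)
  coversRows (z , h) _ = let d , d∈ , d≈z = covD z _ in (d , h) , (d∈ , _) , column d≈z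

  coversColumns : P.Covers U (U ⟨×⟩ E)
  coversColumns (z , h) _ = let e , e∈ , e≈h = covE h _ in (z , e) , (_ , e∈) , row e≈h

  -- An external private neighbour `v` of `d` lies outside `D`, so the fibre over `v` contains no
  -- member and `(v , h)` is private to `(d , h)`.
  irredundantRows : P.Irredundant U (D ⟨×⟩ U)
  irredundantRows (d , h) (d∈ , _) = (v , h) , _ , column d≈v , only′
    where
    private-d = openD d d∈
    v = proj₁ private-d
    v≢d = proj₁ (proj₂ private-d)
    d≈v = proj₁ (proj₂ (proj₂ private-d))
    only = proj₂ (proj₂ (proj₂ private-d))
    only′ : ∀ u → (D ⟨×⟩ U) u → u P.≈ (v , h) → u ≡ (d , h)
    only′ u (u∈ , _) u≈ with ≈-cases u≈
    ... | inj₁ (refl , _)    = contradiction (only v u∈ G.≈-refl) v≢d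
    ... | inj₂ (refl , d′≈v) = cong (_, h) (only _ u∈ d′≈v)

  irredundantColumns : P.Irredundant U (U ⟨×⟩ E)
  irredundantColumns (z , e) (_ , e∈) = (z , v) , _ , row e≈v , only′
    where
    private-e = openE e e∈
    v = proj₁ private-e
    v≢e = proj₁ (proj₂ private-e)
    e≈v = proj₁ (proj₂ (proj₂ private-e))
    only = proj₂ (proj₂ (proj₂ private-e))
    only′ : ∀ u → (U ⟨×⟩ E) u → u P.≈ (z , v) → u ≡ (z , e)
    only′ u (_ , u∈) u≈ with ≈-cases u≈
    ... | inj₁ (refl , e′≈v) = cong (z ,_) (only _ u∈ e′≈v)
    ... | inj₂ (refl , _)    = contradiction (only v u∈ H.≈-refl) v≢e

  g*n≡m*k : g * n ≡ m * k
  g*n≡m*k = begin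
    g * n              ≡⟨ #-× D? U? ⟨
    P.# (D? ×? U?)     ≡⟨ ≤-antisym (minimum (D? ×? U?) (U? ×? E?) coversRows irredundantRows coversColumns)
                                    (minimum (U? ×? E?) (D? ×? U?) coversColumns irredundantColumns coversRows) ⟩
    P.# (U? ×? E?)     ≡⟨ #-× U? E? ⟩
    m * k              ∎
    where open ≡-Reasoning

  instance
    -- Some member of `E` has to dominate `h₀`.
    k≢0 : NonZero k
    k≢0 = >-nonZero (H.#-positive E? _ (proj₁ (proj₂ (covE h₀ _))))

  degree : G.Vertex → ℕ
  degree x = G.# (x G.≈?_)

  -- `R` is a parameter so that one bound serves both for the whole fibre over `x` and for that
  -- fibre minus one vertex.
  Fan : G.Vertex → (H.Vertex → Set) → (P.Vertex → Set)
  Fan x R = ((_≡ x) ⟨×⟩ R) ∪ (∁ (x G.≈_) ⟨×⟩ E)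

  -- Compare with `V(G) × E`: over the complement of `N[x]` both sets coincide, and what remains is
  -- `N[x] × E` against `{x} × R`.
  degree*k≤# : ∀ x {R : H.Vertex → Set} (R? : Decidable R) → P.Covers U (Fan x R) → degree x * k ≤ H.# R?
  degree*k≤# x R? cov = +-cancelʳ-≤ (c * k) _ _ (begin
    degree x * k + c * k        ≡⟨ *-distribʳ-+ k (degree x) c ⟨
    (degree x + c) * k          ≡⟨ cong (_* k) (G.#-∁ (x G.≈?_)) ⟩
    m * k                       ≡⟨ #-× U? E? ⟨
    P.# (U? ×? E?)              ≤⟨ minimum (U? ×? E?) fan? coversColumns irredundantColumns cov ⟩
    P.# fan?                    ≤⟨ P.#-∪-≤ ((G._≟ x) ×? R?) (∁? (x G.≈?_) ×? E?) ⟩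
    P.# ((G._≟ x) ×? R?) + P.# (∁? (x G.≈?_) ×? E?)
                                ≡⟨ cong₂ _+_ (#-× (G._≟ x) R?) (#-× (∁? (x G.≈?_)) E?) ⟩
    G.# (G._≟ x) * H.# R? + c * k
                                ≡⟨ cong (λ i → i * H.# R? + c * k) (G.#-singleton x) ⟩
    1 * H.# R? + c * k          ≡⟨ cong (_+ c * k) (*-identityˡ (H.# R?)) ⟩
    H.# R? + c * k              ∎)
    where
    open ≤-Reasoning
    c = G.# (∁? (x G.≈?_))
    fan? = ((G._≟ x) ×? R?) ∪? (∁? (x G.≈?_) ×? E?)

  degree*k≤n : ∀ x → degree x * k ≤ n
  degree*k≤n x = degree*k≤# x U? cov
    where
    cov : P.Covers U (Fan x U)
    cov (z , h) _ with x G.≈? z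
    ... | yes x≈z = (x , h) , inj₁ (refl , _) , column x≈z
    ... | no x≉z  = let e , e∈ , e≈h = covE h _ in (z , e) , inj₂ (x≉z , e∈) , row e≈h

  dominators? : ∀ z → Decidable (λ d → D d × d G.≈ z)
  dominators? z d = D? d ×-dec (d G.≈? z)

  private
    -- Counts the pairs of a member of `D` and a vertex dominated by it; `total≡` counts them by the
    -- dominated vertex. Every vertex has a dominator, so `m ≤ total`, while the degree bounds give
    -- `total ≤ m`.
    total : ℕ
    total = G.∑ λ d → ind (D? d) * degree d

    total≡ : total ≡ G.∑ λ z → G.# (dominators? z)
    total≡ = begin
      total                                                      ≡⟨ G.∑-cong (λ d → G.∑-*ˡ (ind (D? d)) (λ z → ind (d G.≈? z))) ⟨
      G.∑ (λ d → G.∑ λ z → ind (D? d) * ind (d G.≈? z))          ≡⟨ G.∑-cong (λ d → G.∑-cong λ z → ind-× (D? d) (d G.≈? z)) ⟨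
      G.∑ (λ d → G.∑ λ z → ind (dominators? z d))                ≡⟨ ∑-comm (λ i j → ind (dominators? (Inverse.from G.index j) (Inverse.from G.index i))) ⟩
      G.∑ (λ z → G.# (dominators? z))                            ∎
      where open ≡-Reasoning

    1≤dominators : ∀ z → 1 ≤ G.# (dominators? z)
    1≤dominators z = let d , d∈ , d≈z = covD z _ in G.#-positive (dominators? z) d (d∈ , d≈z)

    weigh-≤ : ∀ d → ind (D? d) * degree d * k ≤ ind (D? d) * n
    weigh-≤ d = ≤-trans (≤-reflexive (*-assoc (ind (D? d)) (degree d) k)) (*-monoʳ-≤ (ind (D? d)) (degree*k≤n d))

    ∑weights : G.∑ (λ d → ind (D? d) * n) ≡ m * k
    ∑weights = trans (G.∑-*ʳ n (λ d → ind (D? d))) g*n≡m*k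

    total≤m : total ≤ m
    total≤m = *-cancelʳ-≤ total m k (begin
      total * k                                   ≡⟨ G.∑-*ʳ k (λ d → ind (D? d) * degree d) ⟨
      G.∑ (λ d → ind (D? d) * degree d * k)       ≤⟨ G.∑-mono weigh-≤ ⟩
      G.∑ (λ d → ind (D? d) * n)                  ≡⟨ ∑weights ⟩
      m * k                                       ∎)
      where open ≤-Reasoning

    m≤total : m ≤ total
    m≤total = ≤-trans (G.∑-mono 1≤dominators) (≤-reflexive (sym total≡))

  -- A second dominator of `z` would push `total` above `m`.
  dominator-unique : ∀ {z d d′} → D d → D d′ → d G.≈ z → d′ G.≈ z → d ≡ d′
  dominator-unique {z} {d} {d′} d∈ d′∈ d≈z d′≈z = decidable-stable (d G.≟ d′) λ d≢d′ →
    let two : 1 < G.# (dominators? z)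
        two = ≤-trans (s≤s (G.#-positive (dominators? z G.∖? d) d′ ((d′∈ , d′≈z) , d≢d′ ∘ sym)))
                      (≤-reflexive (sym (G.#-∖ (dominators? z) d (d∈ , d≈z))))
    in <⇒≱ (<-≤-trans (G.∑-mono-< 1≤dominators z two) (≤-reflexive (sym total≡))) total≤m

  -- A single block with fewer than `n / k` vertices would make `total * k` smaller than `m * k`.
  degree*k≡n : ∀ {x} → D x → degree x * k ≡ n
  degree*k≡n {x} x∈ = ≤-antisym (degree*k≤n x) (≮⇒≥ λ lt → <⇒≱ (begin-strict
    total * k                                   ≡⟨ G.∑-*ʳ k (λ d → ind (D? d) * degree d) ⟨
    G.∑ (λ d → ind (D? d) * degree d * k)       <⟨ G.∑-mono-< weigh-≤ x (weigh-< lt) ⟩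
    G.∑ (λ d → ind (D? d) * n)                  ≡⟨ ∑weights ⟩
    m * k                                       ∎) (*-monoˡ-≤ k m≤total))
    where
    open ≤-Reasoning
    weigh-< : degree x * k < n → ind (D? x) * degree x * k < ind (D? x) * n
    weigh-< lt rewrite ind-yes (D? x) x∈ | +-identityʳ (degree x) | +-identityʳ n = lt

  -- An anchor of x is a private neighbour of x with respect to every set meeting N[x] in x.
  Anchor : G.Vertex → G.Vertex → Set
  Anchor x v = v ≢ x × x G.≈ v × (∀ w → w G.≈ v → x G.≈ w)

  abstract
    -- Without an anchor, Fan x U would remain dominating after the deletion of (x , e).
    anchor : ∀ {x} → D x → ∃ (Anchor x)
    anchor {x} x∈ = decidable-stable anchor? λ ¬anchor →
      <⇒≱ (H.#-∖-< U? e _) (≤-trans (≤-reflexive (sym (degree*k≡n x∈)))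
        (degree*k≤# x (U? H.∖? e) (cov ¬anchor)))
      where
      anchor? : Dec (∃ (Anchor x))
      anchor? = G.∃? λ v → ¬? (v G.≟ x) ×-dec (x G.≈? v) ×-dec G.∀? λ w → (w G.≈? v) →-dec (x G.≈? w)
      e : H.Vertex
      e = proj₁ (covE h₀ _)
      e∈ : E e
      e∈ = proj₁ (proj₂ (covE h₀ _))
      cov : ¬ ∃ (Anchor x) → P.Covers U (Fan x (U H.∖ e))
      cov ¬anchor (z , h) _ with x G.≈? z
      ... | no x≉z = let e′ , e′∈ , e′≈h = covE h _ in (z , e′) , inj₂ (x≉z , e′∈) , row e′≈h
      ... | yes x≈z with h H.≟ e
      ...   | no h≢e = (x , h) , inj₁ (refl , _ , h≢e) , column x≈z
      ...   | yes refl with z G.≟ x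
      -- The deleted vertex is dominated within its own fibre, `H` having no isolated vertices.
      ...     | yes refl = let h′ , h′≢e , e≈h′ = noIsolatedH e
                           in  (x , h′) , inj₁ (refl , _ , h′≢e) , row (H.≈-sym e≈h′)
      ...     | no z≢x with G.∃? (λ w → (w G.≈? z) ×-dec ¬? (x G.≈? w))
      -- A neighbour `w` of `z` outside `N[x]` puts `(w , e)` into the fan; if there is none, `z` is
      -- an anchor.
      ...       | yes (w , w≈z , x≉w) = (w , e) , inj₂ (x≉w , e∈) , column w≈z
      ...       | no ¬escape = contradiction
        (z , z≢x , x≈z , λ w w≈z → decidable-stable (x G.≈? w) λ x≉w → ¬escape (w , w≈z , x≉w)) ¬anchor

  -- If an edge from `z` left the clique `N[x]`, then `N[z]` would strictly contain `N[x]` and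
  -- violate the degree bound. So a block is closed under adjacency and, `G` being connected, it is
  -- everything.
  cliques⇒complete : Connected G →
    (∀ {x} → D x → ∀ a b → x G.≈ a → x G.≈ b → a G.≈ b) → G.Complete
  cliques⇒complete connected clique u v =
    let x , x∈ , x≈u = covD u _ in clique x∈ u v x≈u (reach x∈ x≈u (connected u v))
    where
    closed : ∀ {x z w} → D x → x G.≈ z → z G.≈ w → x G.≈ w
    closed {x} {z} {w} x∈ x≈z z≈w = decidable-stable (x G.≈? w) λ x≉w →
      <⇒≱ (<-≤-trans (*-monoˡ-< k (G.#-mono-< (x G.≈?_) (z G.≈?_) (λ v → clique x∈ z v x≈z) w x≉w z≈w))
                     (degree*k≤n z))
          (≤-reflexive (sym (degree*k≡n x∈)))
    reach : ∀ {x u v} → D x → x G.≈ u → Star G._~_ u v → x G.≈ v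
    reach x∈ x≈u ε          = x≈u
    reach x∈ x≈u (u~w ◅ w⋯v) = reach x∈ (closed x∈ x≈u (inj₂ u~w)) w⋯v

-- Exchange inside one block `N[x] × N[y]`.

module LocalBlocks (G H : Graph) (minimum : Domination.IrredundantMinimum (G □ H))
  (𝒟 : Domination.OpenDominatingSet G) (ℰ : Domination.OpenDominatingSet H)
  (noIsolatedG : Domination.NoIsolated G) (noIsolatedH : Domination.NoIsolated H)
  (g₀ : Graph.Vertex G) (h₀ : Graph.Vertex H) where

  private
    module G = Domination G
    module H = Domination H
    module P = Domination (G □ H)
    open Product G H
    open G.OpenDominatingSet 𝒟
      renaming (Member to D; member? to D?; covers to covD; open-irr to openD)
    open H.OpenDominatingSet ℰ
      renaming (Member to E; member? to E?; covers to covE; open-irr to openE)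
    module GH = Blocks G H minimum 𝒟 ℰ noIsolatedH h₀
    module HG = Blocks H G (flip-irredundantMinimum G H minimum) ℰ 𝒟 noIsolatedG g₀

    n = H.# U?

  -- The two sides are `n / k` and `m / g`, with `m` the order of `G`, and `g * n` equals `m * k`.
  degree-≡ : ∀ {x y} → D x → E y → GH.degree x ≡ HG.degree y
  degree-≡ {x} {y} x∈ y∈ = *-cancelʳ-≡ _ _ g {{HG.k≢0}} (*-cancelʳ-≡ _ _ k {{GH.k≢0}} (begin
    GH.degree x * g * k     ≡⟨ *-assoc (GH.degree x) g k ⟩
    GH.degree x * (g * k)   ≡⟨ cong (GH.degree x *_) (*-comm g k) ⟩
    GH.degree x * (k * g)   ≡⟨ *-assoc (GH.degree x) k g ⟨
    GH.degree x * k * g     ≡⟨ cong (_* g) (GH.degree*k≡n x∈) ⟩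
    n * g                   ≡⟨ *-comm n g ⟩
    g * n                   ≡⟨ GH.g*n≡m*k ⟩
    G.# U? * k              ≡⟨ cong (_* k) (HG.degree*k≡n y∈) ⟨
    HG.degree y * g * k     ∎))
    where
    open ≡-Reasoning
    g = G.# D?
    k = H.# E?

  module _ {x y} (x∈ : D x) (y∈ : E y) {S : P.Vertex → Set} (S? : Decidable S)
    (S⊆ : ∀ u → S u → (G.Block x ⟨×⟩ H.Block y) u)
    (covS : P.Covers (G.Block x ⟨×⟩ H.Block y) S)
    (irrS : P.Irredundant (G.Block x ⟨×⟩ H.Block y) S) where

    private
      -- `T₁` takes care of the vertices over the complement of `N[x]`, `T₂` of those over `N[x]`
      -- but outside `N[y]` in the second coordinate, and `S` of the block.
      T₁ T₂ T : P.Vertex → Set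
      T₁ = (D G.∖ x) ⟨×⟩ U
      T₂ = G.Block x ⟨×⟩ (E H.∖ y)
      T  = T₁ ∪ (T₂ ∪ S)

      T₁? : Decidable T₁
      T₁? = (D? G.∖? x) ×? U?
      T₂? : Decidable T₂
      T₂? = G.block? x ×? (E? H.∖? y)
      T? : Decidable T
      T? = T₁? ∪? (T₂? ∪? S?)

      covT : P.Covers U T
      covT (z , h) _ with x G.≈? z
      ... | no x≉z = let d , d∈ , d≈z = covD z _
                     in  (d , h) , inj₁ ((d∈ , λ { refl → x≉z d≈z }) , _) , column d≈z
      ... | yes x≈z with y H.≈? h
      ...   | no y≉h  = let e , e∈ , e≈h = covE h _
                        in  (z , e) , inj₂ (inj₁ (x≈z , e∈ , λ { refl → y≉h e≈h })) , row e≈h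
      ...   | yes y≈h = let u , s , u≈ = covS (z , h) (x≈z , y≈h) in u , inj₂ (inj₂ s) , u≈

      near₁ : ∀ {z h z′ h′} → (z , h) P.≈ (z′ , h′) → z G.≈ z′
      near₁ u≈ with ≈-cases u≈
      ... | inj₁ (refl , _) = G.≈-refl
      ... | inj₂ (_ , z≈z′) = z≈z′

      near₂ : ∀ {z h z′ h′} → (z , h) P.≈ (z′ , h′) → h H.≈ h′
      near₂ u≈ with ≈-cases u≈
      ... | inj₁ (_ , h≈h′) = h≈h′
      ... | inj₂ (refl , _) = H.≈-refl

      -- Members of `T₁` and `T₂` have private neighbours at anchors: dominators of an anchor of `d`
      -- stay in `N[d]`, and distinct blocks are disjoint, so `S` cannot reach it. Members of `S`
      -- keep their private neighbours, which lie in the block.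
      irrT : P.Irredundant U T
      irrT (d , h) (inj₁ ((d∈ , d≢x) , _)) = (v , h) , _ , column d≈v , only
        where
        v = proj₁ (GH.anchor d∈)
        v≢d = proj₁ (proj₂ (GH.anchor d∈))
        d≈v = proj₁ (proj₂ (proj₂ (GH.anchor d∈)))
        N[v]⊆N[d] = proj₂ (proj₂ (proj₂ (GH.anchor d∈)))
        far : ∀ {z h′} → x G.≈ z → ¬ (z , h′) P.≈ (v , h)
        far x≈z u≈ = d≢x (GH.dominator-unique d∈ x∈ (N[v]⊆N[d] _ (near₁ u≈)) x≈z)
        only : ∀ u → T u → u P.≈ (v , h) → u ≡ (d , h)
        only u (inj₁ ((d′∈ , _) , _)) u≈ with ≈-cases u≈
        ... | inj₁ (refl , _)    = contradiction (GH.dominator-unique d′∈ d∈ G.≈-refl d≈v) v≢d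
        ... | inj₂ (refl , d′≈v) = cong (_, h) (GH.dominator-unique d′∈ d∈ d′≈v d≈v)
        only u (inj₂ (inj₁ (x≈z , _))) u≈ = contradiction u≈ (far x≈z)
        only u (inj₂ (inj₂ s))         u≈ = contradiction u≈ (far (proj₁ (S⊆ u s)))
      irrT (z , e) (inj₂ (inj₁ (x≈z , e∈ , e≢y))) = (z , v) , _ , row e≈v , only
        where
        v = proj₁ (HG.anchor e∈)
        v≢e = proj₁ (proj₂ (HG.anchor e∈))
        e≈v = proj₁ (proj₂ (proj₂ (HG.anchor e∈)))
        N[v]⊆N[e] = proj₂ (proj₂ (proj₂ (HG.anchor e∈)))
        only : ∀ u → T u → u P.≈ (z , v) → u ≡ (z , e)
        only u (inj₁ ((d∈ , d≢x) , _)) u≈ =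
          contradiction (GH.dominator-unique d∈ x∈ (near₁ u≈) x≈z) d≢x
        only u (inj₂ (inj₁ (_ , e′∈ , _))) u≈ with ≈-cases u≈
        ... | inj₁ (refl , e′≈v) = cong (z ,_) (HG.dominator-unique e′∈ e∈ e′≈v e≈v)
        ... | inj₂ (refl , _)    = contradiction (HG.dominator-unique e′∈ e∈ H.≈-refl e≈v) v≢e
        only u (inj₂ (inj₂ s)) u≈ =
          contradiction (HG.dominator-unique e∈ y∈ (N[v]⊆N[e] _ (near₂ u≈)) (proj₂ (S⊆ u s))) e≢y
      irrT u (inj₂ (inj₂ s)) = w , _ , u≈w , only′
        where
        private-u = irrS u s
        w = proj₁ private-u
        x≈w = proj₁ (proj₁ (proj₂ private-u))
        y≈w = proj₂ (proj₁ (proj₂ private-u))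
        u≈w = proj₁ (proj₂ (proj₂ private-u))
        only = proj₂ (proj₂ (proj₂ private-u))
        only′ : ∀ u′ → T u′ → u′ P.≈ w → u′ ≡ u
        only′ u′ (inj₁ ((d∈ , d≢x) , _)) u′≈ =
          contradiction (GH.dominator-unique d∈ x∈ (near₁ u′≈) x≈w) d≢x
        only′ u′ (inj₂ (inj₁ (_ , e∈ , e≢y))) u′≈ =
          contradiction (HG.dominator-unique e∈ y∈ (near₂ u′≈) y≈w) e≢y
        only′ u′ (inj₂ (inj₂ s′)) u′≈ = only u′ s′ u′≈

    -- `T` is at most as large as `D × V(H)`. Since `n` is `r * k` for the block size `r`, removing
    -- `T₁` and `T₂` leaves room for `r` vertices in `S`.
    #≤degree : P.# S? ≤ GH.degree x
    #≤degree = +-cancelˡ-≤ (r * k′) _ _ (+-cancelˡ-≤ (g′ * n) _ _ (begin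
      g′ * n + (r * k′ + P.# S?)             ≡⟨ cong₂ (λ i j → i + (j + P.# S?)) (#-× (D? G.∖? x) U?) (#-× (G.block? x) (E? H.∖? y)) ⟨
      P.# T₁? + (P.# T₂? + P.# S?)           ≡⟨ cong (P.# T₁? +_) (P.#-∪ T₂? S? λ u (_ , e∈ , e≢y) s →
                                                  e≢y (HG.dominator-unique e∈ y∈ H.≈-refl (proj₂ (S⊆ u s)))) ⟨
      P.# T₁? + P.# (T₂? ∪? S?)              ≡⟨ P.#-∪ T₁? (T₂? ∪? S?) disjoint ⟨
      P.# T?                                 ≤⟨ minimum T? (D? ×? U?) covT irrT GH.coversRows ⟩
      P.# (D? ×? U?)                         ≡⟨ #-× D? U? ⟩
      G.# D? * n                             ≡⟨ cong (_* n) (G.#-∖ D? x x∈) ⟩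
      n + g′ * n                             ≡⟨ +-comm n (g′ * n) ⟩
      g′ * n + n                             ≡⟨ cong (g′ * n +_) n≡ ⟩
      g′ * n + (r * k′ + r)                  ∎))
      where
      open ≤-Reasoning
      r  = GH.degree x
      g′ = G.# (D? G.∖? x)
      k′ = H.# (E? H.∖? y)
      n≡ : n ≡ r * k′ + r
      n≡ = trans (sym (GH.degree*k≡n x∈)) (trans (cong (r *_) (H.#-∖ E? y y∈))
             (trans (*-suc r k′) (+-comm r (r * k′))))
      disjoint : ∀ u → T₁ u → ¬ (T₂ ∪ S) u
      disjoint (z , h) ((z∈ , z≢x) , _) t = z≢x (GH.dominator-unique z∈ x∈ G.≈-refl (x≈z t))
        where
        x≈z : (T₂ ∪ S) (z , h) → x G.≈ z
        x≈z (inj₁ (x≈z , _)) = x≈z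
        x≈z (inj₂ s)         = proj₁ (S⊆ _ s)

  -- Blocks with a cover by several vertices are stars.

  module _ {x y} (x∈ : D x) (y∈ : E y) (M : G.ManyCover x) where
    open G.ManyCover M renaming (Member to L; member? to L?)

    -- If p is missing from L, then L × {y} ∪ {x} × (N[y] ∖ y) is irredundant in the block.
    leaf∈manyCover : ∀ p → x G.≈ p → p ≢ x → L p
    leaf∈manyCover p x≈p p≢x = decidable-stable (L? p) λ p∉ → <⇒≱ 2≤# (+-cancelʳ-≤ r′ _ _ (begin
      G.# L? + r′                        ≡⟨ cong₂ _+_ (*-identityʳ (G.# L?)) (*-identityˡ r′) ⟨
      G.# L? * 1 + 1 * r′                ≡⟨ cong₂ (λ i j → G.# L? * i + j * r′) (H.#-singleton y) (G.#-singleton x) ⟨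
      G.# L? * H.# (H._≟ y) + G.# (G._≟ x) * r′
                                         ≡⟨ cong₂ _+_ (#-× L? (H._≟ y)) (#-× (G._≟ x) (H.block? y H.∖? y)) ⟨
      P.# S₁? + P.# S₂?                  ≡⟨ P.#-∪ S₁? S₂? (λ { _ (l , _) (refl , _) → x∉ l }) ⟨
      P.# (S₁? ∪? S₂?)                   ≤⟨ #≤degree x∈ y∈ (S₁? ∪? S₂?) S⊆ covS (irrS p∉) ⟩
      -- Blocks of both factors have the same size, which leaves `# L? ≤ 1`.
      GH.degree x                        ≡⟨ degree-≡ x∈ y∈ ⟩
      HG.degree y                        ≡⟨ H.#-∖ (H.block? y) y H.≈-refl ⟩
      1 + r′                             ∎))
      where
      open ≤-Reasoning
      r′ = H.# (H.block? y H.∖? y)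
      S₁ S₂ S : P.Vertex → Set
      S₁ = L ⟨×⟩ (_≡ y)
      S₂ = (_≡ x) ⟨×⟩ (H.Block y H.∖ y)
      S  = S₁ ∪ S₂
      S₁? = L? ×? (H._≟ y)
      S₂? = (G._≟ x) ×? (H.block? y H.∖? y)
      S⊆ : ∀ u → S u → (G.Block x ⟨×⟩ H.Block y) u
      S⊆ u (inj₁ (l , refl))         = ⊆block _ l , H.≈-refl
      S⊆ u (inj₂ (refl , y≈h , _))   = G.≈-refl , y≈h
      covS : P.Covers (G.Block x ⟨×⟩ H.Block y) S
      covS (z , h) (x≈z , y≈h) with h H.≟ y
      ... | yes refl = let u , l , u≈z = covers z x≈z in (u , h) , inj₁ (l , refl) , column u≈z
      ... | no h≢y   = (x , h) , inj₂ (refl , y≈h , h≢y) , column x≈z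
      irrS : ¬ L p → P.Irredundant (G.Block x ⟨×⟩ H.Block y) S
      irrS p∉ (l , h) (inj₁ (l∈ , refl)) = (w , h) , (x≈w , H.≈-refl) , column l≈w , only′
        where
        w = proj₁ (irredundant l l∈)
        x≈w = proj₁ (proj₂ (irredundant l l∈))
        l≈w = proj₁ (proj₂ (proj₂ (irredundant l l∈)))
        only = proj₂ (proj₂ (proj₂ (irredundant l l∈)))
        -- Every member of `L` dominates `x`, so `x` being private to `l` would force `L` to be a
        -- singleton.
        w≢x : w ≢ x
        w≢x w≡x = <⇒≱ 2≤# (≤-trans
          (G.#-mono L? (G._≟ l) λ v v∈ → only v v∈ (subst (v G.≈_) (sym w≡x) (G.≈-sym (⊆block v v∈)))) (≤-reflexive (G.#-singleton l)))
        only′ : ∀ u → S u → u P.≈ (w , h) → u ≡ (l , h)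
        only′ u (inj₁ (v∈ , refl)) u≈ with ≈-cases u≈
        ... | inj₁ (refl , _) = cong (_, h) (only w v∈ G.≈-refl)
        ... | inj₂ (_ , v≈w)  = cong (_, h) (only _ v∈ v≈w)
        only′ u (inj₂ (refl , _ , h′≢y)) u≈ with ≈-cases u≈
        ... | inj₁ (x≡w , _)  = contradiction (sym x≡w) w≢x
        ... | inj₂ (h′≡y , _) = contradiction h′≡y h′≢y
      -- The missing leaf `p` supplies the private neighbour: as `h ≢ y`, a member of `L × {y}`
      -- could reach `(p , h)` only from `(p , y)`.
      irrS p∉ (_ , h) (inj₂ (refl , y≈h , h≢y)) = (p , h) , (x≈p , y≈h) , column x≈p , only′
        where
        only′ : ∀ u → S u → u P.≈ (p , h) → u ≡ (x , h)
        only′ u (inj₁ (v∈ , refl)) u≈ with ≈-cases u≈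
        ... | inj₁ (refl , _) = contradiction v∈ p∉
        ... | inj₂ (refl , _) = contradiction refl h≢y
        only′ u (inj₂ (refl , _)) u≈ with ≈-cases u≈
        ... | inj₁ (refl , _) = contradiction refl p≢x
        ... | inj₂ (refl , _) = refl

    -- A private neighbour `w ≢ x` of `p` lies in `L` by `leaf∈manyCover`, so it is `p` itself. If
    -- `w` is `x`, then all of `L` dominates it and `q` equals `p` at once.
    manyCover-independent : ∀ {p q} → L p → L q → q G.≈ p → q ≡ p
    manyCover-independent {p} {q} p∈ q∈ q≈p with irredundant p p∈
    ... | w , x≈w , p≈w , only with w G.≟ x
    ...   | yes refl = only q q∈ (G.≈-sym (⊆block q q∈))
    ...   | no w≢x with refl ← only w (leaf∈manyCover w x≈w w≢x) G.≈-refl = only q q∈ q≈p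

-- By leaf∈manyCover both blocks are stars with leaf sets L and R, and L × R ∪ {(x , y)} is too large.
module DoubleStar (G H : Graph) (minimum : Domination.IrredundantMinimum (G □ H))
  (𝒟 : Domination.OpenDominatingSet G) (ℰ : Domination.OpenDominatingSet H)
  (noIsolatedG : Domination.NoIsolated G) (noIsolatedH : Domination.NoIsolated H)
  (g₀ : Graph.Vertex G) (h₀ : Graph.Vertex H) where

  private
    module G = Domination G
    module H = Domination H
    module P = Domination (G □ H)
    open Product G H
    module GH = LocalBlocks G H minimum 𝒟 ℰ noIsolatedG noIsolatedH g₀ h₀
    module HG = LocalBlocks H G (flip-irredundantMinimum G H minimum) ℰ 𝒟 noIsolatedH noIsolatedG h₀ g₀

  module _ {x y} (x∈ : G.OpenDominatingSet.Member 𝒟 x) (y∈ : H.OpenDominatingSet.Member ℰ y)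
    (M : G.ManyCover x) (N : H.ManyCover y) where

    private
      open G.ManyCover M using () renaming (Member to L; member? to L?; ⊆block to L⊆; x∉ to x∉L; 2≤# to 2≤#L)
      open H.ManyCover N using () renaming (Member to R; member? to R?; ⊆block to R⊆; x∉ to y∉R; 2≤# to 2≤#R)

      S₁ S₂ S : P.Vertex → Set
      S₁ = L ⟨×⟩ R
      S₂ = (_≡ x) ⟨×⟩ (_≡ y)
      S  = S₁ ∪ S₂

      S₁? = L? ×? R?
      S₂? = (G._≟ x) ×? (H._≟ y)

      S⊆ : ∀ u → S u → (G.Block x ⟨×⟩ H.Block y) u
      S⊆ u (inj₁ (l , r))       = L⊆ _ l , R⊆ _ r
      S⊆ u (inj₂ (refl , refl)) = G.≈-refl , H.≈-refl

      covS : P.Covers (G.Block x ⟨×⟩ H.Block y) S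
      covS (z , h) (x≈z , y≈h) with z G.≟ x | h H.≟ y
      ... | yes refl | _        = (x , y) , inj₂ (refl , refl) , row y≈h
      ... | no _     | yes refl = (x , y) , inj₂ (refl , refl) , column x≈z
      ... | no z≢x   | no h≢y   = (z , h) , inj₁ (GH.leaf∈manyCover x∈ y∈ M z x≈z z≢x ,
                                                  HG.leaf∈manyCover y∈ x∈ N h y≈h h≢y) , P.≈-refl

      -- Both leaf sets are independent and avoid the centres, so every member is its own private
      -- neighbour.
      irrS : P.Irredundant (G.Block x ⟨×⟩ H.Block y) S
      irrS (l , r) s@(inj₁ (l∈ , r∈)) = (l , r) , S⊆ _ s , P.≈-refl , only
        where
        only : ∀ u → S u → u P.≈ (l , r) → u ≡ (l , r)
        only u (inj₁ (l′∈ , r′∈)) u≈ with ≈-cases u≈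
        ... | inj₁ (refl , r′≈r) = cong (l ,_) (HG.manyCover-independent y∈ x∈ N r∈ r′∈ r′≈r)
        ... | inj₂ (refl , l′≈l) = cong (_, r) (GH.manyCover-independent x∈ y∈ M l∈ l′∈ l′≈l)
        only u (inj₂ (refl , refl)) u≈ with ≈-cases u≈
        ... | inj₁ (refl , _) = contradiction l∈ x∉L
        ... | inj₂ (refl , _) = contradiction r∈ y∉R
      irrS u s@(inj₂ (refl , refl)) = u , S⊆ u s , P.≈-refl , only
        where
        only : ∀ u → S u → u P.≈ (x , y) → u ≡ (x , y)
        only u (inj₁ (l∈ , r∈)) u≈ with ≈-cases u≈
        ... | inj₁ (refl , _) = contradiction l∈ x∉L
        ... | inj₂ (refl , _) = contradiction r∈ y∉R
        only u (inj₂ (refl , refl)) _ = refl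

      -- The right-hand side bounds the size of `N[x]`, whose vertices other than `x` all lie in
      -- `L`.
      #S≤ : G.# L? * H.# R? + 1 ≤ G.# L? + 1
      #S≤ = begin
        G.# L? * H.# R? + 1 * 1              ≡⟨ cong₂ (λ i j → G.# L? * H.# R? + i * j) (G.#-singleton x) (H.#-singleton y) ⟨
        G.# L? * H.# R? + G.# (G._≟ x) * H.# (H._≟ y)
                                             ≡⟨ cong₂ _+_ (#-× L? R?) (#-× (G._≟ x) (H._≟ y)) ⟨
        P.# S₁? + P.# S₂?                    ≡⟨ P.#-∪ S₁? S₂? (λ { _ (l , _) (refl , _) → x∉L l }) ⟨
        P.# (S₁? ∪? S₂?)                     ≤⟨ GH.#≤degree x∈ y∈ (S₁? ∪? S₂?) S⊆ covS irrS ⟩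
        G.# (G.block? x)                     ≡⟨ G.#-∖ (G.block? x) x G.≈-refl ⟩
        suc (G.# (G.block? x G.∖? x))        ≤⟨ s≤s (G.#-mono (G.block? x G.∖? x) L?
                                                  λ z (x≈z , z≢x) → GH.leaf∈manyCover x∈ y∈ M z x≈z z≢x) ⟩
        suc (G.# L?)                         ≡⟨ +-comm 1 (G.# L?) ⟩
        G.# L? + 1                           ∎
        where open ≤-Reasoning

    doubleStar : ⊥
    doubleStar = <⇒≱ 2≤#R (*-cancelˡ-≤ (G.# L?) {{>-nonZero (≤-trans (s≤s z≤n) 2≤#L)}}
      (≤-trans (+-cancelʳ-≤ 1 _ _ #S≤) (≤-reflexive (sym (*-identityʳ (G.# L?))))))

-- Connected graphs that are not complete.

module Nontrivial (Γ : Graph) (connected : Connected Γ) (¬complete : ¬ Domination.Complete Γ) where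
  open Domination Γ

  nonadjacent : ∃ λ u → ∃ λ v → ¬ u ≈ v
  nonadjacent = decidable-stable (∃? λ u → ∃? λ v → ¬? (u ≈? v)) λ ¬gap →
    ¬complete λ u v → decidable-stable (u ≈? v) λ u≉v → ¬gap (u , v , u≉v)

  firstStep : ∀ {v w} → Star _~_ v w → v ≢ w → ∃ λ u → u ≢ v × v ≈ u
  firstStep ε         v≢v = contradiction refl v≢v
  firstStep (v~u ◅ _) _   = _ , (λ u≡v → ~-irrefl (sym u≡v) v~u) , inj₂ v~u

  -- One of `a` and `b` differs from `v`, and the first edge of a walk towards it leads to a
  -- neighbour.
  noIsolated : NoIsolated
  noIsolated v with a , b , a≉b ← nonadjacent with v ≟ a
  ... | yes refl = firstStep (connected v b) λ { refl → a≉b ≈-refl }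
  ... | no v≢a   = firstStep (connected v a) v≢a

  openDominatingSet : OpenDominatingSet
  openDominatingSet = openDominating noIsolated U? (λ w _ → w , _ , ≈-refl) (<-wellFounded _)

  vertex : Vertex
  vertex = proj₁ nonadjacent

-- Conclusion: one of the factors is complete.

module _ (G H : Graph) (connectedG : Connected G) (connectedH : Connected H)
  (¬completeG : ¬ Domination.Complete G) (¬completeH : ¬ Domination.Complete H)
  (minimum : Domination.IrredundantMinimum (G □ H)) where

  private
    module G = Domination G
    module NG = Nontrivial G connectedG ¬completeG
    module NH = Nontrivial H connectedH ¬completeH

  -- If every block of `G` were a clique, `G` would be complete; two nonadjacent vertices of one
  -- block give the cover.
  largeBlock : (𝒟 : G.OpenDominatingSet) → Domination.OpenDominatingSet H →
    Σ[ x ∈ G.Vertex ] G.OpenDominatingSet.Member 𝒟 x × G.ManyCover x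
  largeBlock 𝒟 ℰ with G.∃? (λ x → D? x ×-dec G.∃? λ a → G.∃? λ b →
      (x G.≈? a) ×-dec (x G.≈? b) ×-dec ¬? (a G.≈? b))
    where open G.OpenDominatingSet 𝒟 renaming (member? to D?)
  ... | yes (x , x∈ , a , b , x≈a , x≈b , a≉b) = x , x∈ , G.manyCover x≈a x≈b a≉b
  ... | no ¬gap = contradiction
    (Blocks.cliques⇒complete G H minimum 𝒟 ℰ NH.noIsolated NH.vertex connectedG λ x∈ a b x≈a x≈b →
      decidable-stable (a G.≈? b) λ a≉b → ¬gap (_ , x∈ , a , b , x≈a , x≈b , a≉b))
    ¬completeG

someFactorComplete : (G H : Graph) → Connected G → Connected H → WellDominated (G □ H) →
  Domination.Complete G ⊎ Domination.Complete H
someFactorComplete G H connectedG connectedH wd with Domination.complete? G | Domination.complete? H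
... | yes completeG | _             = inj₁ completeG
... | no _          | yes completeH = inj₂ completeH
... | no ¬completeG | no ¬completeH =
  let _ , x∈ , M = largeBlock G H connectedG connectedH ¬completeG ¬completeH minimum 𝒟 ℰ
      _ , y∈ , N = largeBlock H G connectedH connectedG ¬completeH ¬completeG
                     (flip-irredundantMinimum G H minimum) ℰ 𝒟
  in  ⊥-elim (DoubleStar.doubleStar G H minimum 𝒟 ℰ NG.noIsolated NH.noIsolated NG.vertex NH.vertex x∈ y∈ M N)
  where
  module NG = Nontrivial G connectedG ¬completeG
  module NH = Nontrivial H connectedH ¬completeH
  minimum = Domination.wellDominated⇒irredundantMinimum (G □ H) wd
  𝒟 = NG.openDominatingSet
  ℰ = NH.openDominatingSet

theorem1 : (G H : Graph) → Connected G → Connected H →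
    WellDominated (G □ H) → WellDominated G ⊎ WellDominated H
theorem1 G H connectedG connectedH wd with someFactorComplete G H connectedG connectedH wd
... | inj₁ completeG = inj₁ (Domination.complete⇒wellDominated G completeG)
... | inj₂ completeH = inj₂ (Domination.complete⇒wellDominated H completeH)
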